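{- For every integer $n \geq 5$, $\sigma(K_5 - P_4, n) = 4n - 4$.
   Context: A sequence $S=(d_1,\dots,d_n)$ of non-negative integers is graphical if it is the degree sequence of some simple graph on $n$ vertices (a realization of $S$). A graphical sequence is potentially $H$-graphical if some realization of it contains $H$ as a subgraph. $\sigma(S)=d_1+\dots+d_n$. $P_4$ denotes a path on $5$ vertices (with $4$ edges), and $K_5 - P_4$ is the graph obtained from the complete graph $K_5$ by removing the $4$ edges of a path $P_4$ (a Hamiltonian path of $K_5$). $\sigma(H,n)$ is the smallest even integer $l$ such that every $n$-term graphical sequence $S$ with $\sigma(S)\geq l$ is potentially $H$-graphical. -}

module Defs where

open import Data.Nat using (ℕ; zero; suc; _+_; _≤_; _<_; _≥_)
open import Data.Nat.Properties using (_≟_)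
open import Data.Fin using (Fin; toℕ)
open import Data.Bool using (Bool; true; false; T)
open import Data.List using (List; length; filter)
open import Data.Nat.ListAction using () renaming (sum to listSum)
open import Data.List using (map)
open import Data.Fin using () renaming (_≟_ to _≟ᶠ_)
open import Data.Nat.Base using (_∸_)
open import Data.Product using (Σ; _×_; _,_; ∃)
open import Data.Empty using (⊥)
open import Relation.Nullary using (¬_)
open import Relation.Binary.PropositionalEquality using (_≡_)
open import Function.Definitions using (Injective)
open import Data.List using (allFin)
open import Data.Nat.Divisibility using (_∣_)

record SimpleGraph (n : ℕ) : Set where
  field
    adj   : Fin n → Fin n → Bool
    sym   : ∀ i j → adj i j ≡ adj j i
    irefl : ∀ i → adj i i ≡ false
open SimpleGraph public

degree : ∀ {n} → SimpleGraph n → Fin n → ℕ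
degree G i = length (filter (λ j → T? (adj G i j)) (allFin _))
  where
  open import Data.Bool using (T?)

Seq : ℕ → Set
Seq n = Fin n → ℕ

σ : ∀ {n} → Seq n → ℕ
σ {n} d = listSum (map d (allFin n))

Realizes : ∀ {n} → SimpleGraph n → Seq n → Set
Realizes G d = ∀ i → degree G i ≡ d i

Graphical : ∀ {n} → Seq n → Set
Graphical {n} d = Σ (SimpleGraph n) λ G → Realizes G d

Contains : ∀ {k n} → SimpleGraph n → SimpleGraph k → Set
Contains {k} {n} G H =
  Σ (Fin k → Fin n) λ f → Injective _≡_ _≡_ f ×
    (∀ i j → T (adj H i j) → T (adj G (f i) (f j)))

PotentiallyGraphical : ∀ {k n} → SimpleGraph k → Seq n → Set
PotentiallyGraphical H d = Σ (SimpleGraph _) λ G → Realizes G d × Contains G H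

-- K₅ - P₄: vertices 0..4, remove the path 0-1-2-3-4; i.e. i,j adjacent
-- iff |i - j| ≥ 2.
dist : ℕ → ℕ → ℕ
dist a b = (a ∸ b) + (b ∸ a)

k5p4adj : Fin 5 → Fin 5 → Bool
k5p4adj i j with dist (toℕ i) (toℕ j)
... | 0 = false
... | 1 = false
... | suc (suc _) = true

private
  open import Relation.Binary.PropositionalEquality using (refl)
  open import Data.Fin using (zero; suc)
  k5p4sym : ∀ i j → k5p4adj i j ≡ k5p4adj j i
  k5p4sym zero zero = refl
  k5p4sym zero (suc zero) = refl
  k5p4sym zero (suc (suc zero)) = refl
  k5p4sym zero (suc (suc (suc zero))) = refl
  k5p4sym zero (suc (suc (suc (suc zero)))) = refl
  k5p4sym (suc zero) zero = refl
  k5p4sym (suc zero) (suc zero) = refl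
  k5p4sym (suc zero) (suc (suc zero)) = refl
  k5p4sym (suc zero) (suc (suc (suc zero))) = refl
  k5p4sym (suc zero) (suc (suc (suc (suc zero)))) = refl
  k5p4sym (suc (suc zero)) zero = refl
  k5p4sym (suc (suc zero)) (suc zero) = refl
  k5p4sym (suc (suc zero)) (suc (suc zero)) = refl
  k5p4sym (suc (suc zero)) (suc (suc (suc zero))) = refl
  k5p4sym (suc (suc zero)) (suc (suc (suc (suc zero)))) = refl
  k5p4sym (suc (suc (suc zero))) zero = refl
  k5p4sym (suc (suc (suc zero))) (suc zero) = refl
  k5p4sym (suc (suc (suc zero))) (suc (suc zero)) = refl
  k5p4sym (suc (suc (suc zero))) (suc (suc (suc zero))) = refl
  k5p4sym (suc (suc (suc zero))) (suc (suc (suc (suc zero)))) = refl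
  k5p4sym (suc (suc (suc (suc zero)))) zero = refl
  k5p4sym (suc (suc (suc (suc zero)))) (suc zero) = refl
  k5p4sym (suc (suc (suc (suc zero)))) (suc (suc zero)) = refl
  k5p4sym (suc (suc (suc (suc zero)))) (suc (suc (suc zero))) = refl
  k5p4sym (suc (suc (suc (suc zero)))) (suc (suc (suc (suc zero)))) = refl

  k5p4irr : ∀ i → k5p4adj i i ≡ false
  k5p4irr zero = refl
  k5p4irr (suc zero) = refl
  k5p4irr (suc (suc zero)) = refl
  k5p4irr (suc (suc (suc zero))) = refl
  k5p4irr (suc (suc (suc (suc zero)))) = refl

K5-P4 : SimpleGraph 5
K5-P4 = record { adj = k5p4adj ; sym = k5p4sym ; irefl = k5p4irr }

Even : ℕ → Set
Even l = 2 ∣ l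

Forces : ∀ {k} → SimpleGraph k → ℕ → ℕ → Set
Forces H n l = (d : Seq n) → Graphical d → σ d ≥ l → PotentiallyGraphical H d

SigmaIs : ∀ {k} → SimpleGraph k → ℕ → ℕ → Set
SigmaIs H n l = Even l × Forces H n l × (∀ m → Even m → Forces H n m → l ≤ m)

{-# OPTIONS --safe #-}

-- K₅ - P₄ is the house: a square p q r s with a roof t over the edge p q.
--
-- Lower bound: K₂ ∨ (n-2)K₁ has degree sum 4n - 6, is the only realization of its degrees,
-- and has a vertex cover of size 2, whereas the house has none.
--
-- Upper bound, by induction on n, with n = 5 an exhaustive search.  Let v be a vertex of
-- minimum degree.  Unless deg v = 3, deleting v keeps the degree sum large enough: this is
-- immediate for deg v ≤ 2, and if every degree is at least 4 the sum itself has room.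
-- If deg v = 3, with neighbours a, b, c, replace v by an edge ab when a and b are not
-- adjacent, or else an edge xy outside by xa and yb (or else some x outside is adjacent to
-- two of a, b, c, which gives a house at once).  Induction yields a house and, all
-- degrees but that of c being at least 3, also an edge off some house that avoids c; v is put
-- back by subdividing that edge and joining c.
module Submission where

open import Defs
open import Data.Bool using (Bool; true; false; _∧_; _∨_; if_then_else_; T; T?)
import Data.Bool as Bool
open import Data.Bool.Properties using (∨-comm; ∧-comm; T-≡)
open import Data.Empty using (⊥)
open import Data.Fin using (Fin; zero; suc; _≟_)
open import Data.Fin.Patterns
open import Data.Fin.Permutation as Perm using (Permutation′; _⟨$⟩ʳ_; _⟨$⟩ˡ_)
open import Data.Fin.Properties using (any?)
import Data.Fin.Properties as Fin
open import Data.Fin.Subset using (Subset)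
open import Data.Fin.Subset.Properties using (anySubset?)
open import Data.List using (length; filter; tabulate; map)
open import Data.Nat hiding (_≟_)
open import Data.Nat.Divisibility using (divides)
open import Data.Nat.ListAction using () renaming (sum to listSum)
open import Data.Nat.Properties hiding (_≟_)
open import Data.Nat.Tactic.RingSolver using (solve-∀)
open import Data.Product using (Σ; _×_; _,_; ∃; proj₂)
open import Data.Sum using (_⊎_; inj₁; inj₂)
open import Data.Unit using (⊤; tt)
open import Data.Vec using (Vec; []; _∷_)
import Data.Vec as Vec
import Data.Vec.Functional as F
open import Data.Vec.Properties using (lookup∘tabulate)
open import Data.Vec.Relation.Unary.All using (All; []; _∷_)
open import Data.Vec.Relation.Unary.AllPairs using ([]; _∷_)
open import Data.Vec.Relation.Unary.Unique.Propositional using (Unique)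
open import Data.Vec.Relation.Unary.Unique.Propositional.Properties using (lookup-injective)
open import Function using (_∘_; case_of_; Equivalence)
open import Relation.Binary using (tri<; tri≈; tri>)
open import Relation.Binary.PropositionalEquality
  using (_≡_; _≢_; _≗_; ≢-sym; refl; trans; cong; cong₂; subst; subst₂; module ≡-Reasoning)
  renaming (sym to ≡-sym)
open import Relation.Nullary using (¬_; Dec; yes; no; does; contradiction; ¬?; _×-dec_)
open import Relation.Nullary.Decidable using (dec-true; dec-false; map′; decidable-stable; from-no)
open import Algebra.Properties.CommutativeMonoid.Sum +-0-commutativeMonoid

private variable
  n k : ℕ

-- Indicators, finite sums and counting

⟦_⟧ : Bool → ℕ
⟦ b ⟧ = if b then 1 else 0

⟦⟧≤1 : ∀ b → ⟦ b ⟧ ≤ 1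
⟦⟧≤1 true  = ≤-refl
⟦⟧≤1 false = z≤n

⟦⟧≡1 : ∀ b → ⟦ b ⟧ ≡ 1 → b ≡ true
⟦⟧≡1 true _ = refl

⟦⟧≡0 : ∀ b → ⟦ b ⟧ ≡ 0 → b ≡ false
⟦⟧≡0 false _ = refl

δ : Fin n → Fin n → ℕ
δ x j = ⟦ does (j ≟ x) ⟧

δ-diag : (x : Fin n) → δ x x ≡ 1
δ-diag x = cong ⟦_⟧ (dec-true (x ≟ x) refl)

δ-off : {x j : Fin n} → j ≢ x → δ x j ≡ 0
δ-off {x = x} {j} j≢x = cong ⟦_⟧ (dec-false (j ≟ x) j≢x)

sum-δ : (x : Fin n) → sum (δ x) ≡ 1
sum-δ {suc n} zero    = cong suc (sum-replicate-zero n)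
sum-δ         (suc x) = sum-δ x

sum-const : ∀ n c → sum {n} (λ _ → c) ≡ n * c
sum-const zero    c = refl
sum-const (suc n) c = cong (c +_) (sum-const n c)

sum-ones : ∀ n → sum {n} (λ _ → 1) ≡ n
sum-ones n = trans (sum-const n 1) (*-identityʳ n)

sum-mono : {f g : Fin n → ℕ} → (∀ i → f i ≤ g i) → sum f ≤ sum g
sum-mono {zero}  f≤g = z≤n
sum-mono {suc n} f≤g = +-mono-≤ (f≤g zero) (sum-mono (f≤g ∘ suc))

sum≡0 : {f : Fin n → ℕ} → sum f ≡ 0 → ∀ i → f i ≡ 0
sum≡0 {f = f} eq zero    = m+n≡0⇒m≡0 _ eq
sum≡0 {f = f} eq (suc i) = sum≡0 (m+n≡0⇒n≡0 (f zero) eq) i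

sum-<⇒∃< : (g f : Fin n → ℕ) → sum g < sum f → ∃ λ i → g i < f i
sum-<⇒∃< {suc n} g f lt with f zero ≤? g zero
... | no f≰g  = zero , ≰⇒> f≰g
... | yes f≤g with sum-<⇒∃< (g ∘ suc) (f ∘ suc)
                     (+-cancelˡ-< (g zero) _ _ (<-≤-trans lt (+-monoˡ-≤ _ f≤g)))
...   | i , p = suc i , p

argmin : (f : Fin (suc n) → ℕ) → ∃ λ v → ∀ i → f v ≤ f i
argmin {zero}  f = zero , λ { zero → ≤-refl }
argmin {suc n} f with argmin (f ∘ suc)
... | v , min with ≤-total (f zero) (f (suc v))
...   | inj₁ le = zero , λ { zero → ≤-refl ; (suc i) → ≤-trans le (min i) }
...   | inj₂ ge = suc v , λ { zero → ge ; (suc i) → min i }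

occ : Vec (Fin n) k → Fin n → ℕ
occ []       j = 0
occ (x ∷ xs) j = δ x j + occ xs j

sum-occ : (xs : Vec (Fin n) k) → sum (occ xs) ≡ k
sum-occ {n} []   = sum-replicate-zero n
sum-occ (x ∷ xs) = trans (∑-distrib-+ (δ x) (occ xs)) (cong₂ _+_ (sum-δ x) (sum-occ xs))

occ≡0 : ∀ {w : Fin n} (xs : Vec (Fin n) k) → occ xs w ≡ 0 → All (w ≢_) xs
occ≡0     []       eq = []
occ≡0 {w = w} (x ∷ xs) eq =
  (λ { refl → 1+n≢0 (trans (≡-sym (δ-diag w)) (m+n≡0⇒m≡0 _ eq)) })
  ∷ occ≡0 xs (m+n≡0⇒n≡0 (δ x w) eq)

peel : (f : Fin n → ℕ) → sum f ≡ suc k →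
       ∃ λ x → ∃ λ g → sum g ≡ k × (∀ j → f j ≡ δ x j + g j)
peel {suc n} f eq with f zero in f0
... | suc m = zero , (m F.∷ f ∘ suc) , suc-injective eq , λ { zero → f0 ; (suc j) → refl }
... | zero with peel (f ∘ suc) eq
...   | x , g , sg , h = suc x , (0 F.∷ g) , sg , λ { zero → f0 ; (suc j) → h j }

-- Turns the indicator of a neighbourhood into a list of its members, one `peel` per unit of the
-- sum. Distinctness of the entries is a separate matter.
enumerate : ∀ k (f : Fin n → ℕ) → sum f ≡ k → ∃ λ (xs : Vec (Fin n) k) → f ≗ occ xs
enumerate zero    f eq = [] , sum≡0 eq
enumerate (suc k) f eq with peel f eq
... | x , g , sg , h with enumerate k g sg
...   | xs , e = x ∷ xs , λ j → trans (h j) (cong (δ x j +_) (e j))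

-- Pigeonhole: `occ xs` has sum `k`, so `f` exceeds it at some `w`; as `f w ≤ 1`, this forces
-- `f w ≡ 1` and `occ xs w ≡ 0`.
avoid : (xs : Vec (Fin n) k) (f : Fin n → ℕ) → (∀ i → f i ≤ 1) → k < sum f →
        ∃ λ w → f w ≡ 1 × All (w ≢_) xs
avoid xs f f≤1 lt with sum-<⇒∃< (occ xs) f (subst (_< sum f) (≡-sym (sum-occ xs)) lt)
... | w , p = w , ≤-antisym (f≤1 w) (≤-trans (s≤s z≤n) p)
                , occ≡0 xs (n<1⇒n≡0 (<-≤-trans p (f≤1 w)))

-- Adjacency, degrees and degree sums

Adj : SimpleGraph n → Fin n → Fin n → Set
Adj G i j = adj G i j ≡ true

swap : (G : SimpleGraph n) {i j : Fin n} → Adj G i j → Adj G j i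
swap G e = trans (sym G _ _) e

adj⇒≢ : (G : SimpleGraph n) {i j : Fin n} → Adj G i j → i ≢ j
adj⇒≢ G {i} e refl with trans (≡-sym e) (irefl G i)
... | ()

row : SimpleGraph n → Fin n → Fin n → ℕ
row G i j = ⟦ adj G i j ⟧

deg : SimpleGraph n → Fin n → ℕ
deg G i = sum (row G i)

total : SimpleGraph n → ℕ
total G = sum (deg G)

length-filter-tabulate : {A : Set} (p : A → Bool) (f : Fin n → A) →
  length (filter (T? ∘ p) (tabulate f)) ≡ sum (⟦_⟧ ∘ p ∘ f)
length-filter-tabulate {zero}  p f = refl
length-filter-tabulate {suc n} p f with p (f zero)
... | true  = cong suc (length-filter-tabulate p (f ∘ suc))
... | false = length-filter-tabulate p (f ∘ suc)

degree≡deg : (G : SimpleGraph n) → ∀ i → degree G i ≡ deg G i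
degree≡deg G i = length-filter-tabulate (adj G i) (λ j → j)

σ≡sum : (d : Seq n) → σ d ≡ sum d
σ≡sum d = go d (λ i → i)
  where
  go : ∀ {m} {A : Set} (d : A → ℕ) (f : Fin m → A) → listSum (map d (tabulate f)) ≡ sum (d ∘ f)
  go {zero}  d f = refl
  go {suc m} d f = cong (d (f zero) +_) (go d (f ∘ suc))

another : (G : SimpleGraph n) (i : Fin n) (xs : Vec (Fin n) k) → k < deg G i →
          ∃ λ w → Adj G i w × All (w ≢_) xs
another G i xs lt with avoid xs (row G i) (λ j → ⟦⟧≤1 _) lt
... | w , e , ws = w , ⟦⟧≡1 _ e , ws

SameDegrees : SimpleGraph n → SimpleGraph n → Set
SameDegrees G′ G = ∀ i → deg G′ i ≡ deg G i

-- Removing and attaching a vertex, relabelling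

restrict : SimpleGraph (suc n) → SimpleGraph n
restrict G = record
  { adj   = λ i j → adj G (suc i) (suc j)
  ; sym   = λ i j → sym G (suc i) (suc j)
  ; irefl = λ i → irefl G (suc i)
  }

-- Converse of `restrict`: the new vertex is joined exactly to the vertices selected by `r`.
cone : (Fin n → Bool) → SimpleGraph n → SimpleGraph (suc n)
cone {n} r G = record { adj = a ; sym = s ; irefl = λ { zero → refl ; (suc i) → irefl G i } }
  where
  a : Fin (suc n) → Fin (suc n) → Bool
  a zero    zero    = false
  a zero    (suc j) = r j
  a (suc i) zero    = r i
  a (suc i) (suc j) = adj G i j
  s : ∀ i j → a i j ≡ a j i
  s zero    zero    = refl
  s zero    (suc j) = refl
  s (suc i) zero    = refl
  s (suc i) (suc j) = sym G i j

-- Read along the column, so that `deg G (suc j)` unfolds to `apex G j + deg (restrict G) j`.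
apex : SimpleGraph (suc n) → Fin n → ℕ
apex G j = row G (suc j) zero

deg-zero : (G : SimpleGraph (suc n)) → deg G zero ≡ sum (apex G)
deg-zero G = cong₂ _+_ (cong ⟦_⟧ (irefl G zero))
  (sum-cong-≗ (λ j → cong ⟦_⟧ (sym G zero (suc j))))

-- The edges at the apex count twice: once in its own degree and once over the degrees of its
-- neighbours.
total-restrict : (G : SimpleGraph (suc n)) → total G ≡ 2 * deg G zero + total (restrict G)
total-restrict G = begin
  deg G zero + sum (λ i → apex G i + deg (restrict G) i)
    ≡⟨ cong (deg G zero +_) (∑-distrib-+ (apex G) _) ⟩
  deg G zero + (sum (apex G) + total (restrict G))
    ≡⟨ cong (λ s → deg G zero + (s + total (restrict G))) (deg-zero G) ⟨
  deg G zero + (deg G zero + total (restrict G))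
    ≡⟨ lemma (deg G zero) _ ⟩
  2 * deg G zero + total (restrict G) ∎
  where
  open ≡-Reasoning
  lemma : ∀ a b → a + (a + b) ≡ 2 * a + b
  lemma = solve-∀

relabel : Permutation′ n → SimpleGraph n → SimpleGraph n
relabel π G = record
  { adj   = λ i j → adj G (π ⟨$⟩ʳ i) (π ⟨$⟩ʳ j)
  ; sym   = λ i j → sym G _ _
  ; irefl = λ i → irefl G _
  }

deg-relabel : (π : Permutation′ n) (G : SimpleGraph n) → ∀ i → deg (relabel π G) i ≡ deg G (π ⟨$⟩ʳ i)
deg-relabel π G i = ≡-sym (sum-permute (row G (π ⟨$⟩ʳ i)) π)

total-relabel : (π : Permutation′ n) (G : SimpleGraph n) → total (relabel π G) ≡ total G
total-relabel π G = trans (sum-cong-≗ (deg-relabel π G)) (≡-sym (sum-permute (deg G) π))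

-- Changing a single edge

onEdge : Fin n → Fin n → Fin n → Fin n → Bool
onEdge x y i j = (does (i ≟ x) ∧ does (j ≟ y)) ∨ (does (i ≟ y) ∧ does (j ≟ x))

onEdge-sym : (x y i j : Fin n) → onEdge x y i j ≡ onEdge x y j i
onEdge-sym x y i j = trans (∨-comm (does (i ≟ x) ∧ does (j ≟ y)) _)
  (cong₂ _∨_ (∧-comm (does (i ≟ y)) (does (j ≟ x))) (∧-comm (does (i ≟ x)) (does (j ≟ y))))

onEdge-missˡ : {x y i j : Fin n} → x ≢ i → x ≢ j → onEdge x y i j ≡ false
onEdge-missˡ {x = x} {y} {i} {j} x≢i x≢j
  rewrite dec-false (i ≟ x) (≢-sym x≢i) | dec-false (j ≟ x) (≢-sym x≢j)
  = ∧-comm (does (i ≟ y)) false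

onEdge-missʳ : {x y i j : Fin n} → y ≢ i → y ≢ j → onEdge x y i j ≡ false
onEdge-missʳ {x = x} {y} {i} {j} y≢i y≢j
  rewrite dec-false (i ≟ y) (≢-sym y≢i) | dec-false (j ≟ y) (≢-sym y≢j)
  = trans (∨-comm _ false) (∧-comm (does (i ≟ x)) false)

onEdge-diag : {x y : Fin n} → x ≢ y → ∀ i → onEdge x y i i ≡ false
onEdge-diag {x = x} {y} x≢y i with i ≟ x
... | no i≢x = ∧-comm (does (i ≟ y)) false
... | yes refl rewrite dec-false (i ≟ y) x≢y = refl

setEdge : Bool → (x y : Fin n) → x ≢ y → SimpleGraph n → SimpleGraph n
setEdge b x y x≢y G = record
  { adj   = λ i j → if onEdge x y i j then b else adj G i j
  ; sym   = λ i j → cong₂ (λ c d → if c then b else d) (onEdge-sym x y i j) (sym G i j)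
  ; irefl = λ i → cong₂ (λ c d → if c then b else d) (onEdge-diag x≢y i) (irefl G i)
  }

module _ {G : SimpleGraph n} {b : Bool} {x y : Fin n} (x≢y : x ≢ y) where

  -- One end of the changed edge lying off the pair `i`, `j` is enough for the entry to survive.
  setEdge-missˡ : ∀ {i j v} → x ≢ i → x ≢ j → adj G i j ≡ v → adj (setEdge b x y x≢y G) i j ≡ v
  setEdge-missˡ {i} {j} p q eq rewrite onEdge-missˡ {x = x} {y} {i} {j} p q = eq

  setEdge-missʳ : ∀ {i j v} → y ≢ i → y ≢ j → adj G i j ≡ v → adj (setEdge b x y x≢y G) i j ≡ v
  setEdge-missʳ {i} {j} p q eq rewrite onEdge-missʳ {x = x} {y} {i} {j} p q = eq

sum-onEdge : {x y : Fin n} → x ≢ y → ∀ i → sum (λ j → ⟦ onEdge x y i j ⟧) ≡ δ x i + δ y i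
sum-onEdge {n} {x} {y} x≢y i with i ≟ x | i ≟ y
... | yes refl | yes refl = contradiction refl x≢y
... | yes refl | no  _    = trans (sum-cong-≗ (λ j → cong ⟦_⟧ (∨-comm (does (j ≟ y)) false))) (sum-δ y)
... | no _     | yes refl = sum-δ x
... | no _     | no  _    = sum-replicate-zero n

addEdge removeEdge : (x y : Fin n) → x ≢ y → SimpleGraph n → SimpleGraph n
addEdge    = setEdge true
removeEdge = setEdge false

module _ (G : SimpleGraph n) {x y : Fin n} (x≢y : x ≢ y) where

  private
    onEdge⇒adj : ∀ {v} i j → adj G x y ≡ v → onEdge x y i j ≡ true → adj G i j ≡ v
    onEdge⇒adj i j eq on with i ≟ x | j ≟ y
    ... | yes refl | yes refl = eq
    ... | yes refl | no  _    with i ≟ y | j ≟ x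
    ...   | yes refl | _ = contradiction refl x≢y
    onEdge⇒adj i j eq () | yes refl | no _ | no _ | _
    onEdge⇒adj i j eq on | no _ | _ with i ≟ y | j ≟ x
    ... | yes refl | yes refl = trans (sym G _ _) eq
    onEdge⇒adj i j eq () | no _ | _ | yes _ | no _
    onEdge⇒adj i j eq () | no _ | _ | no _ | _

  deg-addEdge : adj G x y ≡ false → ∀ i → deg (addEdge x y x≢y G) i ≡ δ x i + δ y i + deg G i
  deg-addEdge eq i = begin
    deg (addEdge x y x≢y G) i
      ≡⟨ sum-cong-≗ entry ⟩
    sum (λ j → ⟦ onEdge x y i j ⟧ + row G i j)
      ≡⟨ ∑-distrib-+ (λ j → ⟦ onEdge x y i j ⟧) (row G i) ⟩
    sum (λ j → ⟦ onEdge x y i j ⟧) + deg G i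
      ≡⟨ cong (_+ deg G i) (sum-onEdge x≢y i) ⟩
    δ x i + δ y i + deg G i ∎
    where
    open ≡-Reasoning
    entry : ∀ j → row (addEdge x y x≢y G) i j ≡ ⟦ onEdge x y i j ⟧ + row G i j
    entry j with onEdge x y i j in on
    ... | false = refl
    ... | true rewrite onEdge⇒adj i j eq on = refl

  deg-removeEdge : Adj G x y → ∀ i → δ x i + δ y i + deg (removeEdge x y x≢y G) i ≡ deg G i
  deg-removeEdge eq i = begin
    δ x i + δ y i + deg (removeEdge x y x≢y G) i
      ≡⟨ cong (_+ deg (removeEdge x y x≢y G) i) (sum-onEdge x≢y i) ⟨
    sum (λ j → ⟦ onEdge x y i j ⟧) + deg (removeEdge x y x≢y G) i
      ≡⟨ ∑-distrib-+ (λ j → ⟦ onEdge x y i j ⟧) _ ⟨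
    sum (λ j → ⟦ onEdge x y i j ⟧ + row (removeEdge x y x≢y G) i j)
      ≡⟨ sum-cong-≗ entry ⟩
    deg G i ∎
    where
    open ≡-Reasoning
    entry : ∀ j → ⟦ onEdge x y i j ⟧ + row (removeEdge x y x≢y G) i j ≡ row G i j
    entry j with onEdge x y i j in on
    ... | false = refl
    ... | true rewrite onEdge⇒adj i j eq on = refl

-- Houses

-- Only the four non-adjacent pairs need an explicit inequality; the other six pairs are edges,
-- hence distinct.
record House (G : SimpleGraph n) : Set where
  constructor house
  field
    t p q r s : Fin n
    tp : Adj G t p
    tq : Adj G t q
    pq : Adj G p q
    qr : Adj G q r
    rs : Adj G r s
    sp : Adj G s p
    t≢r : t ≢ r
    t≢s : t ≢ s
    p≢r : p ≢ r
    q≢s : q ≢ s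

mirror : {G : SimpleGraph n} → House G → House G
mirror {G = G} (house t p q r s tp tq pq qr rs sp t≢r t≢s p≢r q≢s) =
  house t q p s r tq tp (swap G pq) (swap G sp) (swap G rs) (swap G qr) t≢s t≢r q≢s p≢r

house⇒contains : (G : SimpleGraph n) → House G → Contains G K5-P4
house⇒contains {n} G (house t p q r s tp tq pq qr rs sp t≢r t≢s p≢r q≢s) =
  f , lookup-injective unique _ _ , edge
  where
  vs : Vec (Fin n) 5
  -- The non-edges `p r`, `r t`, `t s`, `s q` of the house form the removed path, so this order
  -- matches 0-1-2-3-4.
  vs = p ∷ r ∷ t ∷ s ∷ q ∷ []
  f : Fin 5 → Fin n
  f = Vec.lookup vs
  unique : Unique vs
  unique = (p≢r ∷ ≢-sym (adj⇒≢ G tp) ∷ ≢-sym (adj⇒≢ G sp) ∷ adj⇒≢ G pq ∷ [])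
         ∷ (≢-sym t≢r ∷ adj⇒≢ G rs ∷ ≢-sym (adj⇒≢ G qr) ∷ [])
         ∷ (t≢s ∷ adj⇒≢ G tq ∷ [])
         ∷ (≢-sym q≢s ∷ [])
         ∷ [] ∷ []
  e : ∀ {i j} → Adj G i j → T (adj G i j)
  e = Equivalence.from T-≡
  edge : ∀ i j → T (adj K5-P4 i j) → T (adj G (f i) (f j))
  edge 0F 2F _ = e (swap G tp)
  edge 0F 3F _ = e (swap G sp)
  edge 0F 4F _ = e pq
  edge 1F 3F _ = e rs
  edge 1F 4F _ = e (swap G qr)
  edge 2F 0F _ = e tp
  edge 2F 4F _ = e tq
  edge 3F 0F _ = e sp
  edge 3F 1F _ = e (swap G rs)
  edge 3F 2F ()
  edge 3F 3F ()
  edge 3F 4F ()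
  edge 4F 0F _ = e (swap G pq)
  edge 4F 1F _ = e qr
  edge 4F 2F _ = e (swap G tq)
  edge 4F 3F ()
  edge 4F 4F ()

contains⇒house : (G : SimpleGraph n) → Contains G K5-P4 → House G
contains⇒house G (f , inj , edge) =
  house (f 2F) (f 0F) (f 4F) (f 1F) (f 3F)
    (e 2F 0F tt) (e 2F 4F tt) (e 0F 4F tt) (e 4F 1F tt) (e 1F 3F tt) (e 3F 0F tt)
    ((λ ()) ∘ inj) ((λ ()) ∘ inj) ((λ ()) ∘ inj) ((λ ()) ∘ inj)
  where
  e : ∀ i j → T (adj K5-P4 i j) → Adj G (f i) (f j)
  e i j = Equivalence.to T-≡ ∘ edge i j

map-house : {m n : ℕ} {G : SimpleGraph m} {G′ : SimpleGraph n} (f : Fin m → Fin n) →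
            (∀ {i j} → f i ≡ f j → i ≡ j) → (∀ {i j} → Adj G i j → Adj G′ (f i) (f j)) →
            House G → House G′
map-house f inj hom (house t p q r s tp tq pq qr rs sp t≢r t≢s p≢r q≢s) =
  house (f t) (f p) (f q) (f r) (f s) (hom tp) (hom tq) (hom pq) (hom qr) (hom rs) (hom sp)
    (t≢r ∘ inj) (t≢s ∘ inj) (p≢r ∘ inj) (q≢s ∘ inj)

-- Each condition is tested as soon as its vertices are chosen, which prunes the search.
house? : (G : SimpleGraph n) → Dec (House G)
house? G = map′
  (λ (t , p , tp , q , tq , pq , r , qr , t≢r , p≢r , s , rs , sp , t≢s , q≢s) →
     house t p q r s tp tq pq qr rs sp t≢r t≢s p≢r q≢s)
  (λ (house t p q r s tp tq pq qr rs sp t≢r t≢s p≢r q≢s) →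
     t , p , tp , q , tq , pq , r , qr , t≢r , p≢r , s , rs , sp , t≢s , q≢s)
  (any? λ t → any? λ p → adj? t p ×-dec
   any? λ q → adj? t q ×-dec adj? p q ×-dec
   any? λ r → adj? q r ×-dec ¬? (t ≟ r) ×-dec ¬? (p ≟ r) ×-dec
   any? λ s → adj? r s ×-dec adj? s p ×-dec ¬? (t ≟ s) ×-dec ¬? (q ≟ s))
  where
  adj? : ∀ i j → Dec (Adj G i j)
  adj? i j = adj G i j Bool.≟ true

-- Realizing the same degrees with a house

Forcible : SimpleGraph n → Set
Forcible G = Σ (SimpleGraph _) λ G′ → SameDegrees G′ G × House G′

house⇒forcible : (G : SimpleGraph n) → House G → Forcible G
house⇒forcible G h = G , (λ _ → refl) , h

forcible-relabel : (π : Permutation′ n) (G : SimpleGraph n) → Forcible (relabel π G) → Forcible G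
forcible-relabel π G (G′ , same , h) =
  relabel (Perm.flip π) G′ ,
  (λ i → trans (deg-relabel (Perm.flip π) G′ i)
        (trans (same _) (trans (deg-relabel π G _) (cong (deg G) (Perm.inverseʳ π))))) ,
  map-house (π ⟨$⟩ʳ_)
    (λ eq → trans (≡-sym (Perm.inverseˡ π)) (trans (cong (π ⟨$⟩ˡ_) eq) (Perm.inverseˡ π)))
    (λ e → trans (cong₂ (adj G′) (Perm.inverseˡ π) (Perm.inverseˡ π)) e) h

-- Attaching the apex to its old neighbours adds the same amount to every degree on both sides, and
-- keeps the house.
forcible-restrict : (G : SimpleGraph (suc n)) → Forcible (restrict G) → Forcible G
forcible-restrict G (G′ , same , h) =
  cone (λ i → adj G (suc i) zero) G′ ,
  (λ { zero → ≡-sym (deg-zero G) ; (suc i) → cong (apex G i +_) (same i) }) ,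
  map-house suc Fin.suc-injective (λ e → e) h

-- Exhaustive search on five vertices

-- A graph as the list of its successive cone rows, which makes graphs on a fixed number
-- of vertices exhaustively searchable.
Code : ℕ → Set
Code zero    = ⊤
Code (suc n) = Subset n × Code n

decode : Code n → SimpleGraph n
decode {zero}  _       = record { adj = λ () ; sym = λ () ; irefl = λ () }
decode {suc n} (r , c) = cone (Vec.lookup r) (decode c)

encode : SimpleGraph n → Code n
encode {zero}  G = tt
encode {suc n} G = Vec.tabulate (λ i → adj G (suc i) zero) , encode (restrict G)

decode-encode : (G : SimpleGraph n) → ∀ i j → adj (decode (encode G)) i j ≡ adj G i j
decode-encode G zero    zero    = ≡-sym (irefl G zero)
decode-encode G zero    (suc j) = trans (lookup∘tabulate _ j) (sym G _ _)
decode-encode G (suc i) zero    = lookup∘tabulate _ i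
decode-encode G (suc i) (suc j) = decode-encode (restrict G) i j

anyCode? : {P : Code n → Set} → (∀ c → Dec (P c)) → Dec (∃ P)
anyCode? {zero}  P? = map′ (tt ,_) proj₂ (P? tt)
anyCode? {suc n} P? = map′ (λ (r , c , p) → (r , c) , p) (λ ((r , c) , p) → r , c , p)
  (anySubset? λ r → anyCode? λ c → P? (r , c))

-- At most two of the ten edges are missing, and any two edges of K₅ lie on a Hamiltonian path. So
-- `G` itself has a house, without changing the realization.
house-on-five : (G : SimpleGraph 5) → 16 ≤ total G → House G
house-on-five G le = map-house (λ i → i) (λ eq → eq) (λ {i} {j} → trans (≡-sym (decode-encode G i j)))
  (decidable-stable (house? (decode (encode G))) λ none → noCounterexample (encode G , le′ , none))
  where
  noCounterexample : ¬ ∃ λ (c : Code 5) → 16 ≤ total (decode c) × ¬ House (decode c)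
  -- Decided by running through all 1024 codes.
  noCounterexample = from-no (anyCode? {5} λ c → (16 ≤? total (decode c)) ×-dec ¬? (house? (decode c)))
  le′ : 16 ≤ total (decode (encode G))
  le′ = subst (16 ≤_) (sum-cong-≗ λ i → sum-cong-≗ λ j → cong ⟦_⟧ (≡-sym (decode-encode G i j))) le

-- Edges that a house can do without

record Spare (G : SimpleGraph n) (c : Fin n) : Set where
  constructor spare
  field
    x y   : Fin n
    x≢y   : x ≢ y
    xy    : Adj G x y
    c≢x   : c ≢ x
    c≢y   : c ≢ y
    saved : House (removeEdge x y x≢y G)

module _ {G : SimpleGraph n} {c : Fin n} where

  -- The only house edges at `t` are `t p` and `t q`, so `t w` is not one of them, even if `w` is
  -- `r` or `s`.
  spare-at-t : (h : House G) → let open House h in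
               c ≢ t → ∀ w → Adj G t w → w ≢ p → w ≢ q → c ≢ w → Spare G c
  spare-at-t (house t p q r s tp tq pq qr rs sp t≢r t≢s p≢r q≢s) c≢t w tw w≢p w≢q c≢w =
    spare t w t≢w tw c≢t c≢w
      (house t p q r s (y t≢w (≢-sym t≢w) w≢p tp) (y t≢w (≢-sym t≢w) w≢q tq)
        (x t≢w t≢p t≢q pq) (x t≢w t≢q t≢r qr) (x t≢w t≢r t≢s rs) (x t≢w t≢s t≢p sp)
        t≢r t≢s p≢r q≢s)
    where
    x = setEdge-missˡ {G = G} {b = false}
    y = setEdge-missʳ {G = G} {b = false}
    t≢w = adj⇒≢ G tw
    t≢p = adj⇒≢ G tp
    t≢q = adj⇒≢ G tq

  spare-at-r : (h : House G) → let open House h in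
               c ≢ r → ∀ w → Adj G r w → w ≢ q → w ≢ s → c ≢ w → Spare G c
  spare-at-r (house t p q r s tp tq pq qr rs sp t≢r t≢s p≢r q≢s) c≢r w rw w≢q w≢s c≢w =
    spare r w r≢w rw c≢r c≢w
      (house t p q r s (x r≢w (≢-sym t≢r) r≢p tp) (x r≢w (≢-sym t≢r) r≢q tq)
        (x r≢w r≢p r≢q pq) (y r≢w w≢q (≢-sym r≢w) qr) (y r≢w (≢-sym r≢w) w≢s rs)
        (x r≢w r≢s r≢p sp) t≢r t≢s p≢r q≢s)
    where
    x = setEdge-missˡ {G = G} {b = false}
    y = setEdge-missʳ {G = G} {b = false}
    r≢w = adj⇒≢ G rw
    r≢p = ≢-sym p≢r
    r≢q = ≢-sym (adj⇒≢ G qr)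
    r≢s = adj⇒≢ G rs

  -- With the chord t r, the house t q r on the square q r s p t does without the edge p q.
  spare-pq : (h : House G) → let open House h in c ≢ p → c ≢ q → Adj G t r → Spare G c
  spare-pq (house t p q r s tp tq pq qr rs sp t≢r t≢s p≢r q≢s) c≢p c≢q tr =
    spare p q p≢q pq c≢p c≢q
      (house q t r s p (x p≢q p≢q p≢t (swap G tq)) (x p≢q p≢q p≢r qr)
        (x p≢q p≢t p≢r tr) (x p≢q p≢r p≢s rs) (y p≢q q≢s (≢-sym p≢q) sp)
        (y p≢q (≢-sym p≢q) q≢t (swap G tp)) q≢s (≢-sym p≢q) t≢s (≢-sym p≢r))
    where
    x = setEdge-missˡ {G = G} {b = false}
    y = setEdge-missʳ {G = G} {b = false}
    p≢q = adj⇒≢ G pq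
    p≢t = ≢-sym (adj⇒≢ G tp)
    p≢s = ≢-sym (adj⇒≢ G sp)
    q≢t = ≢-sym (adj⇒≢ G tq)

  -- When c sees t, r and s, it is a roof over r s, and t is no longer needed.
  spare-tp : (h : House G) → let open House h in
             c ≢ t → c ≢ p → c ≢ q → Adj G c s → Adj G c r → Spare G c
  spare-tp (house t p q r s tp tq pq qr rs sp t≢r t≢s p≢r q≢s) c≢t c≢p c≢q cs cr =
    spare t p t≢p tp c≢t c≢p
      (house c s r q p (x (≢-sym c≢t) t≢s cs) (x (≢-sym c≢t) t≢r cr)
        (x t≢s t≢r (swap G rs)) (x t≢r t≢q (swap G qr)) (x t≢q t≢p (swap G pq))
        (x t≢p t≢s (swap G sp)) c≢q c≢p (≢-sym q≢s) (≢-sym p≢r))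
    where
    t≢p = adj⇒≢ G tp
    t≢q = adj⇒≢ G tq
    x : ∀ {i j} → t ≢ i → t ≢ j → Adj G i j → Adj (removeEdge t p t≢p G) i j
    x = setEdge-missˡ {G = G} {b = false} t≢p

  -- In the house `t`, `r` and `s` have degree 2, so each of them other than `c` has a further edge,
  -- which is spare unless it ends in `c`. If `c` is `r` or `s`, the edge is taken at the other one;
  -- if `c` is `t`, an edge from `r` to `c` is the chord of `spare-pq`.
  spare-edge : (∀ i → c ≢ i → 3 ≤ deg G i) → House G → Spare G c
  spare-edge ≥3 h@(house t p q r s tp tq pq qr rs sp t≢r t≢s p≢r q≢s)
    with c ≟ t | c ≟ r | c ≟ s
  ... | _ | yes refl | _ = case another G s (p ∷ r ∷ []) (≥3 s (adj⇒≢ G rs)) of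
    λ { (w , sw , w≢p ∷ w≢r ∷ []) →
        spare-at-r (mirror h) (adj⇒≢ G rs) w sw w≢p w≢r (≢-sym w≢r) }
  ... | _ | no c≢r | yes refl = case another G r (q ∷ s ∷ []) (≥3 r c≢r) of
    λ { (w , rw , w≢q ∷ w≢s ∷ []) → spare-at-r h c≢r w rw w≢q w≢s (≢-sym w≢s) }
  ... | yes refl | no c≢r | no _ with another G r (q ∷ s ∷ []) (≥3 r c≢r)
  ...   | w , rw , w≢q ∷ w≢s ∷ [] with c ≟ w
  ...     | yes refl = spare-pq h (adj⇒≢ G tp) (adj⇒≢ G tq) (swap G rw)
  ...     | no c≢w   = spare-at-r h c≢r w rw w≢q w≢s c≢w
  spare-edge ≥3 h@(house t p q r s tp tq pq qr rs sp t≢r t≢s p≢r q≢s)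
      | no c≢t | no c≢r | no c≢s
    with another G t (p ∷ q ∷ []) (≥3 t c≢t)
       | another G r (q ∷ s ∷ []) (≥3 r c≢r)
       | another G s (p ∷ r ∷ []) (≥3 s c≢s)
  ... | w₁ , tw , w≢p ∷ w≢q ∷ [] | w₂ , rw , w₂≢q ∷ w₂≢s ∷ [] | w₃ , sw , w₃≢p ∷ w₃≢r ∷ []
    with c ≟ w₁ | c ≟ w₂ | c ≟ w₃
  ...   | no c≢w   | _        | _        = spare-at-t h c≢t w₁ tw w≢p w≢q c≢w
  ...   | yes refl | no c≢w   | _        = spare-at-r h c≢r w₂ rw w₂≢q w₂≢s c≢w
  ...   | yes refl | yes refl | no c≢w   = spare-at-r (mirror h) c≢s w₃ sw w₃≢p w₃≢r c≢w
  -- All three further neighbours are `c`, so `w≢p` and `w≢q` now say that `c` differs from `p` and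
  -- `q`.
  ...   | yes refl | yes refl | yes refl = spare-tp h c≢t w≢p w≢q (swap G sw) (swap G rw)

-- Two reductions: deleting the apex and undoing a subdivision

module _ {c x y : Fin n} (c≢x : c ≢ x) (c≢y : c ≢ y) (x≢y : x ≢ y) where

  oneOf : Fin n → Bool
  oneOf j = does (j ≟ c) ∨ does (j ≟ x) ∨ does (j ≟ y)

  -- Distinctness of the three vertices keeps the disjunction from merging two occurrences.
  ⟦oneOf⟧ : ∀ j → ⟦ oneOf j ⟧ ≡ occ (c ∷ x ∷ y ∷ []) j
  ⟦oneOf⟧ j with j ≟ c | j ≟ x | j ≟ y
  ... | yes refl | yes refl | _        = contradiction refl c≢x
  ... | yes refl | no _     | yes refl = contradiction refl c≢y
  ... | yes refl | no _     | no _     = refl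
  ... | no _     | yes refl | yes refl = contradiction refl x≢y
  ... | no _     | yes refl | no _     = refl
  ... | no _     | no _     | yes refl = refl
  ... | no _     | no _     | no _     = refl

-- The bound `4 * n ∸ 4`, with the 4 moved across to avoid truncated subtraction.
Forced : ℕ → Set
Forced n = (G : SimpleGraph n) → 4 * n ≤ 4 + total G → Forcible G

delete-apex : Forced n → (G : SimpleGraph (suc n)) →
              2 * deg G zero + 4 * n ≤ 4 + total G → Forcible G
delete-apex {n} IH G le = forcible-restrict G (IH (restrict G) (+-cancelˡ-≤ (2 * deg G zero) _ _ (begin
  2 * deg G zero + 4 * n                    ≤⟨ le ⟩
  4 + total G                               ≡⟨ cong (4 +_) (total-restrict G) ⟩
  4 + (2 * deg G zero + total (restrict G)) ≡⟨ lemma (2 * deg G zero) _ ⟩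
  2 * deg G zero + (4 + total (restrict G)) ∎)))
  where
  open ≤-Reasoning
  lemma : ∀ a b → 4 + (a + b) ≡ a + (4 + b)
  lemma = solve-∀

-- Instead of deleting an apex of degree 3 outright, G₁ lets two of its neighbours keep
-- their degree.  In a realization of the degrees of G₁, the apex then subdivides a spare
-- edge and is joined to the third neighbour c.
subdivide : Forced n → (G : SimpleGraph (suc n)) → 4 * suc n ≤ 4 + total G →
            deg G zero ≡ 3 → (∀ i → 3 ≤ deg G i) →
            (c : Fin n) (G₁ : SimpleGraph n) → (∀ i → δ c i + deg G₁ i ≡ deg G (suc i)) →
            Forcible G
subdivide {n} IH G le deg≡3 ≥3 c G₁ degrees = finish (IH G₁ le₁)
  where
  le₁ : 4 * n ≤ 4 + total G₁
  -- The apex takes away 3 and `c` takes away 1: the sum drops by 4, exactly as the bound does.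
  le₁ = +-cancelˡ-≤ 4 _ _ (begin
    4 + 4 * n                                ≡⟨ *-suc 4 n ⟨
    4 * suc n                                ≤⟨ le ⟩
    4 + (deg G zero + sum (deg G ∘ suc))     ≡⟨ cong₂ (λ a b → 4 + (a + b)) deg≡3
                                                  (sum-cong-≗ (≡-sym ∘ degrees)) ⟩
    4 + (3 + sum (λ i → δ c i + deg G₁ i))   ≡⟨ cong (7 +_) (∑-distrib-+ (δ c) (deg G₁)) ⟩
    4 + (3 + (sum (δ c) + total G₁))         ≡⟨ cong (λ a → 7 + (a + total G₁)) (sum-δ c) ⟩
    4 + (4 + total G₁)                       ∎)
    where open ≤-Reasoning
  finish : Forcible G₁ → Forcible G
  finish (G₂ , same , h) with spare-edge {G = G₂} {c}
    (λ i c≢i → subst (3 ≤_) (≡-sym (trans (same i) (trans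
      (cong (_+ deg G₁ i) (≡-sym (δ-off (≢-sym c≢i)))) (degrees i)))) (≥3 (suc i))) h
  ... | spare x y x≢y xy c≢x c≢y saved =
    cone (oneOf c≢x c≢y x≢y) (removeEdge x y x≢y G₂) , same′ , map-house suc Fin.suc-injective (λ e → e) saved
    where
    open ≡-Reasoning
    lemma : ∀ a b c d → a + (b + (c + 0)) + d ≡ a + (b + c + d)
    lemma = solve-∀
    same′ : SameDegrees (cone (oneOf c≢x c≢y x≢y) (removeEdge x y x≢y G₂)) G
    same′ zero = begin
      sum (λ j → ⟦ oneOf c≢x c≢y x≢y j ⟧) ≡⟨ sum-cong-≗ (⟦oneOf⟧ c≢x c≢y x≢y) ⟩
      sum (occ (c ∷ x ∷ y ∷ []))         ≡⟨ sum-occ (c ∷ x ∷ y ∷ []) ⟩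
      3                                  ≡⟨ deg≡3 ⟨
      deg G zero                         ∎
    -- `x` and `y` trade the removed edge for one to the apex, while `c` gains the unit it lacked.
    same′ (suc i) = begin
      ⟦ oneOf c≢x c≢y x≢y i ⟧ + deg (removeEdge x y x≢y G₂) i
        ≡⟨ cong (_+ deg (removeEdge x y x≢y G₂) i) (⟦oneOf⟧ c≢x c≢y x≢y i) ⟩
      occ (c ∷ x ∷ y ∷ []) i + deg (removeEdge x y x≢y G₂) i
        ≡⟨ lemma (δ c i) (δ x i) (δ y i) _ ⟩
      δ c i + (δ x i + δ y i + deg (removeEdge x y x≢y G₂) i)
        ≡⟨ cong (δ c i +_) (deg-removeEdge G₂ x≢y xy i) ⟩
      δ c i + deg G₂ i
        ≡⟨ cong (δ c i +_) (same i) ⟩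
      δ c i + deg G₁ i
        ≡⟨ degrees i ⟩
      deg G (suc i) ∎

-- An apex of degree 3

-- a, b and c (named as vertices of restrict G) are the neighbours of the apex.
record Star (G : SimpleGraph (suc n)) (a b c : Fin n) : Set where
  constructor star
  field
    apex≗ : ∀ j → apex G j ≡ δ a j + δ b j + δ c j
    a≢b : a ≢ b
    a≢c : a ≢ c
    b≢c : b ≢ c

  ax : Adj G (suc a) zero
  ax = ⟦⟧≡1 _ (trans (apex≗ a) (cong₂ _+_ (cong₂ _+_ (δ-diag a) (δ-off a≢b)) (δ-off a≢c)))

  apex-off : ∀ {j} → j ≢ a → j ≢ b → j ≢ c → apex G j ≡ 0
  apex-off j≢a j≢b j≢c = trans (apex≗ _) (cong₂ _+_ (cong₂ _+_ (δ-off j≢a) (δ-off j≢b)) (δ-off j≢c))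

rotate : {G : SimpleGraph (suc n)} {a b c : Fin n} → Star G a b c → Star G b c a
rotate {a = a} {b} {c} (star apex≗ a≢b a≢c b≢c) =
  star (λ j → trans (apex≗ j) (lemma (δ a j) (δ b j) (δ c j))) b≢c (≢-sym a≢b) (≢-sym a≢c)
  where
  lemma : ∀ x y z → x + y + z ≡ y + z + x
  lemma = solve-∀

flip₁₂ : {G : SimpleGraph (suc n)} {a b c : Fin n} → Star G a b c → Star G b a c
flip₁₂ {a = a} {b} {c} (star apex≗ a≢b a≢c b≢c) =
  star (λ j → trans (apex≗ j) (cong (_+ δ c j) (+-comm (δ a j) _))) (≢-sym a≢b) b≢c a≢c

-- A repetition among the three listed neighbours would make some value of `apex G` at least 2, yet
-- it is an indicator.
find-star : (G : SimpleGraph (suc n)) → deg G zero ≡ 3 → ∃ λ a → ∃ λ b → ∃ λ c → Star G a b c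
find-star G deg≡3 with enumerate 3 (apex G) (trans (≡-sym (deg-zero G)) deg≡3)
... | a ∷ b ∷ c ∷ [] , e = a , b , c , star apex≗ a≢b a≢c b≢c
  where
  apex≗ : ∀ j → apex G j ≡ δ a j + δ b j + δ c j
  apex≗ j = trans (e j) (lemma (δ a j) (δ b j) (δ c j))
    where
    lemma : ∀ x y z → x + (y + (z + 0)) ≡ x + y + z
    lemma = solve-∀
  ≤1 : ∀ j → δ a j + δ b j + δ c j ≤ 1
  ≤1 j = subst (_≤ 1) (apex≗ j) (⟦⟧≤1 _)
  a≢b : a ≢ b
  a≢b refl = 1+n≰n (≤-trans (≤-trans (≤-reflexive (≡-sym (cong₂ _+_ (δ-diag a) (δ-diag a))))
    (m≤m+n _ (δ c a))) (≤1 a))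
  a≢c : a ≢ c
  a≢c refl = 1+n≰n (≤-trans (≤-trans (≤-reflexive (≡-sym (cong₂ _+_ (δ-diag a) (δ-diag a))))
    (+-monoˡ-≤ (δ a a) (m≤m+n _ (δ b a)))) (≤1 a))
  b≢c : b ≢ c
  b≢c refl = 1+n≰n (≤-trans (≤-trans (≤-reflexive (≡-sym (cong₂ _+_ (δ-diag b) (δ-diag b))))
    (+-monoˡ-≤ (δ b b) (m≤n+m _ (δ a b)))) (≤1 b))

-- Together with the apex, the three neighbours span a K₄.
record Clique (G : SimpleGraph (suc n)) (a b c : Fin n) : Set where
  constructor clique
  field
    isStar : Star G a b c
    ab : Adj (restrict G) a b
    ac : Adj (restrict G) a c
    bc : Adj (restrict G) b c

rotateᶜ : {G : SimpleGraph (suc n)} {a b c : Fin n} → Clique G a b c → Clique G b c a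
rotateᶜ {G = G} (clique st ab ac bc) = clique (rotate st) bc (swap (restrict G) ab) (swap (restrict G) ac)

-- The square runs through `a`, `b`, `c` and the apex, and `x` is the roof over `a b`.
clique-house : {G : SimpleGraph (suc n)} {a b c : Fin n} → Clique G a b c →
               ∀ x → x ≢ c → Adj (restrict G) x a → Adj (restrict G) x b → House G
clique-house {G = G} {a} {b} {c} (clique st ab ac bc) x x≢c xa xb =
  house (suc x) (suc a) (suc b) (suc c) zero xa xb ab bc
    (Star.ax (rotate (rotate st))) (swap G (Star.ax st))
    (x≢c ∘ Fin.suc-injective) (λ ()) (Star.a≢c st ∘ Fin.suc-injective) (λ ())

≢true : ∀ {b} → b ≡ false → b ≢ true
≢true refl ()

module Apex₃ (IH : Forced n) (G : SimpleGraph (suc n)) (le : 4 * suc n ≤ 4 + total G)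
             (deg≡3 : deg G zero ≡ 3) (≥3 : ∀ i → 3 ≤ deg G i) (5≤n : 5 ≤ n) where

  H : SimpleGraph n
  H = restrict G

  -- Deleting the apex costs `a`, `b` and `c` one degree each; `G₁` repays `a` and `b`, leaving only
  -- `c` short as in `subdivide`.
  keep-ab : ∀ {a b c} → Star G a b c → (G₁ : SimpleGraph n) →
            (∀ i → deg G₁ i ≡ δ a i + δ b i + deg H i) → Forcible G
  keep-ab {a} {b} {c} st G₁ eq = subdivide IH G le deg≡3 ≥3 c G₁ λ i → begin
    δ c i + deg G₁ i                    ≡⟨ cong (δ c i +_) (eq i) ⟩
    δ c i + (δ a i + δ b i + deg H i)   ≡⟨ +-assoc (δ c i) _ _ ⟨
    δ c i + (δ a i + δ b i) + deg H i   ≡⟨ cong (_+ deg H i) (+-comm (δ c i) _) ⟩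
    δ a i + δ b i + δ c i + deg H i     ≡⟨ cong (_+ deg H i) (Star.apex≗ st i) ⟨
    deg G (suc i)                       ∎
    where open ≡-Reasoning

  nonadjacent : ∀ {a b c} → Star G a b c → adj H a b ≡ false → Forcible G
  nonadjacent st a≁b = keep-ab st (addEdge _ _ (Star.a≢b st) H) (deg-addEdge H (Star.a≢b st) a≁b)

  -- Replacing `x y` by `x a` and `y b` preserves the degrees of `x` and `y` and raises those of `a`
  -- and `b`.
  switch : ∀ {a b c} → Star G a b c → ∀ {x y} → Adj H x y →
           adj H x a ≡ false → adj H y b ≡ false →
           x ≢ a → x ≢ b → y ≢ a → y ≢ b → Forcible G
  switch {a} {b} {c} st {x} {y} xy x≁a y≁b x≢a x≢b y≢a y≢b = keep-ab st H₃ degrees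
    where
    x≢y = adj⇒≢ H xy
    H₁ = removeEdge x y x≢y H
    H₂ = addEdge x a x≢a H₁
    H₃ = addEdge y b y≢b H₂
    x≁a₁ : adj H₁ x a ≡ false
    x≁a₁ = setEdge-missʳ {G = H} x≢y (≢-sym x≢y) y≢a x≁a
    -- Both earlier changes are at edges through `x`, which is neither `y` nor `b`.
    y≁b₂ : adj H₂ y b ≡ false
    y≁b₂ = setEdge-missˡ {G = H₁} x≢a x≢y x≢b (setEdge-missˡ {G = H} x≢y x≢y x≢b y≁b)
    lemma : ∀ x a y b h → y + b + (x + a + h) ≡ a + b + (x + y + h)
    lemma = solve-∀
    open ≡-Reasoning
    degrees : ∀ i → deg H₃ i ≡ δ a i + δ b i + deg H i
    degrees i = begin
      deg H₃ i                                      ≡⟨ deg-addEdge H₂ y≢b y≁b₂ i ⟩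
      δ y i + δ b i + deg H₂ i                      ≡⟨ cong (δ y i + δ b i +_) (deg-addEdge H₁ x≢a x≁a₁ i) ⟩
      δ y i + δ b i + (δ x i + δ a i + deg H₁ i)    ≡⟨ lemma (δ x i) (δ a i) (δ y i) (δ b i) _ ⟩
      δ a i + δ b i + (δ x i + δ y i + deg H₁ i)    ≡⟨ cong (δ a i + δ b i +_) (deg-removeEdge H x≢y xy i) ⟩
      δ a i + δ b i + deg H i                       ∎

  -- As `x` is not adjacent to the apex, all its neighbours lie in `H`, and one of them, `y`, is not
  -- `c`. If `y` misses `a` or `b`, the edge `x y` can be switched; otherwise `y` is the roof of a
  -- house.
  outside : ∀ {a b c} → Clique G a b c → ∀ x → x ≢ a → x ≢ b → x ≢ c →
            adj H x a ≡ false → adj H x b ≡ false → Forcible G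
  outside {a} {b} {c} cl x x≢a x≢b x≢c x≁a x≁b with another H x (c ∷ []) 1<deg
    where
    1<deg : 1 < deg H x
    1<deg = ≤-trans (n≤1+n 2) (subst (λ m → 3 ≤ m + deg H x)
      (Star.apex-off (Clique.isStar cl) x≢a x≢b x≢c) (≥3 (suc x)))
  ... | y , xy , y≢c ∷ [] with adj H y a in ya | adj H y b in yb
  ...   | _     | false = switch (Clique.isStar cl) xy x≁a yb x≢a x≢b y≢a y≢b
    where
    y≢a = λ { refl → ≢true x≁a xy }
    y≢b = λ { refl → ≢true x≁b xy }
  ...   | false | true  = switch (flip₁₂ (Clique.isStar cl)) xy x≁b ya x≢b x≢a y≢b y≢a
    where
    y≢a = λ { refl → ≢true x≁a xy }
    y≢b = λ { refl → ≢true x≁b xy }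
  ...   | true  | true  = house⇒forcible G (clique-house cl y y≢c ya yb)

  -- A fourth vertex `x` exists, and two of its three adjacencies to `a`, `b`, `c` agree: two
  -- present give a house, two absent lead to `outside`.
  adjacent : ∀ {a b c} → Clique G a b c → Forcible G
  adjacent {a} {b} {c} cl with avoid (a ∷ b ∷ c ∷ []) (λ _ → 1) (λ _ → ≤-refl)
    (subst (3 <_) (≡-sym (sum-ones n)) (≤-trans (n≤1+n 4) 5≤n))
  ... | x , _ , x≢a ∷ x≢b ∷ x≢c ∷ [] with adj H x a in xa | adj H x b in xb | adj H x c in xc
  ...   | true  | true  | _     = house⇒forcible G (clique-house cl x x≢c xa xb)
  ...   | _     | true  | true  = house⇒forcible G (clique-house (rotateᶜ cl) x x≢a xb xc)
  ...   | true  | _     | true  = house⇒forcible G (clique-house (rotateᶜ (rotateᶜ cl)) x x≢b xc xa)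
  ...   | false | false | _     = outside cl x x≢a x≢b x≢c xa xb
  ...   | _     | false | false = outside (rotateᶜ cl) x x≢b x≢c x≢a xb xc
  ...   | false | _     | false = outside (rotateᶜ (rotateᶜ cl)) x x≢c x≢a x≢b xc xa

  forcible : Forcible G
  forcible with find-star G deg≡3
  ... | a , b , c , st with adj H a b in ab | adj H b c in bc | adj H c a in ca
  ...   | false | _     | _     = nonadjacent st ab
  ...   | _     | false | _     = nonadjacent (rotate st) bc
  ...   | _     | _     | false = nonadjacent (rotate (rotate st)) ca
  ...   | true  | true  | true  = adjacent (clique st ab (swap H ca) bc)

-- The induction on the number of vertices

forcible-minApex : 5 ≤ n → Forced n → (G : SimpleGraph (suc n)) →
                   (∀ i → deg G zero ≤ deg G i) → 4 * suc n ≤ 4 + total G → Forcible G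
forcible-minApex {n} 5≤n IH G min le with <-cmp (deg G zero) 3
... | tri< d<3 _ _ = delete-apex IH G (begin
  2 * deg G zero + 4 * n ≤⟨ +-monoˡ-≤ (4 * n) (*-monoʳ-≤ 2 (s≤s⁻¹ d<3)) ⟩
  4 + 4 * n              ≡⟨ *-suc 4 n ⟨
  4 * suc n              ≤⟨ le ⟩
  4 + total G            ∎)
  where open ≤-Reasoning
... | tri≈ _ d≡3 _ = Apex₃.forcible IH G le d≡3 (λ i → subst (_≤ deg G i) d≡3 (min i)) 5≤n
... | tri> _ _ d>3 = delete-apex IH G (begin
  2 * d + 4 * n           ≡⟨ cong (λ m → 2 * d + 4 * m) n≡1+m ⟩
  2 * d + 4 * suc m       ≡⟨ cong (2 * d +_) (*-suc 4 m) ⟩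
  -- Of the `n + 1 = m + 2` degrees, each at least `d`, two pay for `2 * d` and the other `m` for
  -- `4 * m`.
  2 * d + (4 + 4 * m)     ≤⟨ +-monoʳ-≤ (2 * d) (+-monoʳ-≤ 4 (*-monoˡ-≤ m d>3)) ⟩
  2 * d + (4 + d * m)     ≡⟨ lemma d m ⟩
  4 + suc (suc m) * d     ≡⟨ cong (λ k → 4 + suc k * d) n≡1+m ⟨
  4 + suc n * d           ≡⟨ cong (4 +_) (sum-const (suc n) d) ⟨
  4 + sum {suc n} (λ _ → d) ≤⟨ +-monoʳ-≤ 4 (sum-mono min) ⟩
  4 + total G             ∎)
  where
  open ≤-Reasoning
  d = deg G zero
  m = pred n
  n≡1+m : n ≡ suc m
  n≡1+m = ≡-sym (suc-pred n {{>-nonZero (≤-trans (s≤s z≤n) 5≤n)}})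
  lemma : ∀ d m → 2 * d + (4 + d * m) ≡ 4 + suc (suc m) * d
  lemma = solve-∀

forced-suc : 5 ≤ n → Forced n → Forced (suc n)
forced-suc {n} 5≤n IH G le with argmin (deg G)
... | v , min = forcible-relabel π G (forcible-minApex 5≤n IH (relabel π G)
  (λ i → subst₂ _≤_ (≡-sym (deg-relabel π G zero)) (≡-sym (deg-relabel π G i)) (min (π ⟨$⟩ʳ i)))
  (subst (λ s → 4 * suc n ≤ 4 + s) (≡-sym (total-relabel π G)) le))
  where
  π = Perm.transpose zero v

forced-five : Forced 5
forced-five G le = house⇒forcible G (house-on-five G (+-cancelˡ-≤ 4 16 (total G) le))

forced : ∀ k → Forced (5 + k)
forced zero    = forced-five
forced (suc k) = forced-suc (m≤m+n 5 k) (forced k)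

-- The lower bound: the book and its only realization

all-true : (p : Fin n → Bool) → sum (⟦_⟧ ∘ p) ≡ n → ∀ i → p i ≡ true
all-true {suc n} p eq i with p zero in p0
... | false = contradiction
  (subst₂ _≤_ eq (sum-ones n) (sum-mono (λ j → ⟦⟧≤1 (p (suc j))))) 1+n≰n
all-true {suc n} p eq zero    | true = p0
all-true {suc n} p eq (suc i) | true = all-true (p ∘ suc) (suc-injective eq) i

empty : ∀ n → SimpleGraph n
empty n = record { adj = λ _ _ → false ; sym = λ _ _ → refl ; irefl = λ _ → refl }

-- K₂ ∨ (m K₁)
book : ∀ m → SimpleGraph (2 + m)
book m = cone (λ _ → true) (cone (λ _ → true) (empty m))

total-empty : ∀ n → total (empty n) ≡ 0
total-empty n = trans (sum-cong-≗ {n} (λ _ → sum-replicate-zero n)) (sum-replicate-zero n)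

total-book : ∀ m → total (book m) ≡ 2 + 4 * m
total-book m = begin
  total (book m)
    ≡⟨ total-restrict (book m) ⟩
  2 * suc (sum {m} (λ _ → 1)) + total (restrict (book m))
    ≡⟨ cong (2 * suc (sum {m} (λ _ → 1)) +_) (total-restrict (restrict (book m))) ⟩
  2 * suc (sum {m} (λ _ → 1)) + (2 * sum {m} (λ _ → 1) + total (empty m))
    ≡⟨ cong₂ (λ a b → 2 * suc a + (2 * a + b)) (sum-ones m) (total-empty m) ⟩
  2 * suc m + (2 * m + 0)
    ≡⟨ lemma m ⟩
  2 + 4 * m ∎
  where
  open ≡-Reasoning
  lemma : ∀ m → 2 * suc m + (2 * m + 0) ≡ 2 + 4 * m
  lemma = solve-∀

module _ {m : ℕ} (G : SimpleGraph (2 + m)) (same : SameDegrees G (book m)) where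

  Spine : Fin (2 + m) → Set
  Spine x = x ≡ 0F ⊎ x ≡ 1F

  private
    -- Degree `m + 1` joins each of the first two vertices to everything else, and this exhausts the
    -- degree 2 of every page.
    to-0F : ∀ j → Adj G (suc j) 0F
    to-0F = all-true (λ j → adj G (suc j) 0F)
      (trans (≡-sym (deg-zero G)) (trans (same 0F) (cong suc (sum-ones m))))

    to-1F : ∀ j → Adj G (suc (suc j)) 1F
    to-1F = all-true (λ j → adj G (suc (suc j)) 1F)
      (trans (≡-sym (deg-zero (restrict G))) (suc-injective (trans
        (cong (λ b → ⟦ b ⟧ + deg (restrict G) zero) (≡-sym (to-0F zero)))
        (trans (same 1F) (cong suc (sum-ones m))))))

    page : ∀ i j → adj G (suc (suc i)) (suc (suc j)) ≡ false
    page i j = ⟦⟧≡0 _ (sum≡0 (suc-injective (suc-injective (trans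
      (cong₂ (λ a b → ⟦ a ⟧ + (⟦ b ⟧ + deg (restrict (restrict G)) i))
        (≡-sym (to-0F (suc i))) (≡-sym (to-1F i)))
      (trans (same (suc (suc i))) (cong (2 +_) (sum-replicate-zero m)))))) j)

  spine-covers : ∀ x y → Adj G x y → Spine x ⊎ Spine y
  spine-covers 0F            y             e = inj₁ (inj₁ refl)
  spine-covers 1F            y             e = inj₁ (inj₂ refl)
  spine-covers (suc (suc i)) 0F            e = inj₂ (inj₁ refl)
  spine-covers (suc (suc i)) 1F            e = inj₂ (inj₂ refl)
  spine-covers (suc (suc i)) (suc (suc j)) e = contradiction e (≢true (page i j))

  spine-size : ∀ {x y z} → x ≢ y → x ≢ z → y ≢ z → Spine x → Spine y → Spine z → ⊥
  spine-size x≢y x≢z y≢z (inj₁ refl) (inj₁ refl) _           = x≢y refl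
  spine-size x≢y x≢z y≢z (inj₁ refl) (inj₂ refl) (inj₁ refl) = x≢z refl
  spine-size x≢y x≢z y≢z (inj₁ refl) (inj₂ refl) (inj₂ refl) = y≢z refl
  spine-size x≢y x≢z y≢z (inj₂ refl) (inj₁ refl) (inj₁ refl) = y≢z refl
  spine-size x≢y x≢z y≢z (inj₂ refl) (inj₁ refl) (inj₂ refl) = x≢z refl
  spine-size x≢y x≢z y≢z (inj₂ refl) (inj₂ refl) _           = x≢y refl

  -- A vertex cover of the house takes two vertices of the roof and one of the edge r s.
  no-house : ¬ House G
  no-house (house t p q r s tp tq pq qr rs sp t≢r t≢s p≢r q≢s)
    with spine-covers t p tp | spine-covers t q tq | spine-covers p q pq | spine-covers r s rs
  ... | inj₁ t∈ | inj₁ _  | inj₁ p∈ | inj₁ r∈ = spine-size (adj⇒≢ G tp) t≢r p≢r t∈ p∈ r∈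
  ... | inj₁ t∈ | inj₁ _  | inj₁ p∈ | inj₂ s∈ = spine-size (adj⇒≢ G tp) t≢s (≢-sym (adj⇒≢ G sp)) t∈ p∈ s∈
  ... | inj₁ t∈ | inj₂ q∈ | _       | inj₁ r∈ = spine-size (adj⇒≢ G tq) t≢r (adj⇒≢ G qr) t∈ q∈ r∈
  ... | inj₁ t∈ | inj₂ q∈ | _       | inj₂ s∈ = spine-size (adj⇒≢ G tq) t≢s q≢s t∈ q∈ s∈
  ... | inj₁ t∈ | inj₁ _  | inj₂ q∈ | inj₁ r∈ = spine-size (adj⇒≢ G tq) t≢r (adj⇒≢ G qr) t∈ q∈ r∈
  ... | inj₁ t∈ | inj₁ _  | inj₂ q∈ | inj₂ s∈ = spine-size (adj⇒≢ G tq) t≢s q≢s t∈ q∈ s∈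
  ... | inj₂ p∈ | inj₁ t∈ | _       | inj₁ r∈ = spine-size (adj⇒≢ G tp) t≢r p≢r t∈ p∈ r∈
  ... | inj₂ p∈ | inj₁ t∈ | _       | inj₂ s∈ = spine-size (adj⇒≢ G tp) t≢s (≢-sym (adj⇒≢ G sp)) t∈ p∈ s∈
  ... | inj₂ p∈ | inj₂ q∈ | _       | inj₁ r∈ = spine-size (adj⇒≢ G pq) p≢r (adj⇒≢ G qr) p∈ q∈ r∈
  ... | inj₂ p∈ | inj₂ q∈ | _       | inj₂ s∈ = spine-size (adj⇒≢ G pq) (≢-sym (adj⇒≢ G sp)) q≢s p∈ q∈ s∈

-- The value of `σ(K₅ - P₄, n)`

realizes⇒same : {G G′ : SimpleGraph n} → Realizes G′ (degree G) → SameDegrees G′ G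
realizes⇒same {G = G} {G′} re i =
  trans (≡-sym (degree≡deg G′ i)) (trans (re i) (degree≡deg G i))

σ-degree : (G : SimpleGraph n) → σ (degree G) ≡ total G
σ-degree G = trans (σ≡sum (degree G)) (sum-cong-≗ (degree≡deg G))

forced⇒forces : ∀ l → 4 * n ≤ 4 + l → Forced n → Forces K5-P4 n l
forced⇒forces {n} l 4n≤4+l IH d (G , re) l≤σ with IH G (begin
  4 * n         ≤⟨ 4n≤4+l ⟩
  4 + l         ≤⟨ +-monoʳ-≤ 4 l≤σ ⟩
  4 + σ d       ≡⟨ cong (4 +_) (σ≡sum d) ⟩
  4 + sum d     ≡⟨ cong (4 +_) (sum-cong-≗ (λ i → trans (≡-sym (re i)) (degree≡deg G i))) ⟩
  4 + total G   ∎)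
  where open ≤-Reasoning
... | G′ , same , h =
  G′ , (λ i → trans (degree≡deg G′ i) (trans (same i) (trans (≡-sym (degree≡deg G i)) (re i)))) ,
  house⇒contains G′ h

-- Otherwise the degree sequence of the book would reach the threshold `l`, although no realization
-- of it has a house.
forces⇒> : ∀ m l → Forces K5-P4 (2 + m) l → 2 + 4 * m < l
forces⇒> m l F = ≰⇒> λ l≤ → refute (F (degree (book m)) (book m , λ _ → refl)
  (subst (l ≤_) (≡-sym (trans (σ-degree (book m)) (total-book m))) l≤))
  where
  refute : ¬ PotentiallyGraphical K5-P4 (degree (book m))
  refute (G , re , c) = no-house G (realizes⇒same {G = book m} {G} re) (contains⇒house G c)

theorem3 : (n : ℕ) → n ≥ 5 → SigmaIs K5-P4 n (4 * n ∸ 4)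
theorem3 n n≥5 with k , refl ← m≤n⇒∃[o]m+o≡n n≥5 =
  divides (8 + 2 * k) even , forced⇒forces _ (m≤n+m∸n (4 * (5 + k)) 4) (forced k) , minimal
  where
  open ≡-Reasoning
  l = 4 * (5 + k) ∸ 4
  even : l ≡ (8 + 2 * k) * 2
  even = cong (_∸ 4) {y = 4 + (8 + 2 * k) * 2} (lemma k)
    where
    lemma : ∀ k → 4 * (5 + k) ≡ 4 + (8 + 2 * k) * 2
    lemma = solve-∀
  lemma : ∀ k → 2 + 4 * (3 + k) ≡ (7 + 2 * k) * 2
  lemma = solve-∀
  minimal : ∀ m → Even m → Forces K5-P4 (5 + k) m → l ≤ m
  -- Evenness closes the gap between `4n - 6 < m` and `4n - 4 ≤ m`: halving turns the former into
  -- `7 + 2 * k < e`.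
  minimal m (divides e refl) F = subst (_≤ e * 2) (≡-sym even) (*-monoˡ-≤ 2
    (*-cancelʳ-< 2 (7 + 2 * k) e (subst (_< e * 2) (lemma k) (forces⇒> (3 + k) (e * 2) F))))
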